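{- Let $\Gamma$ denote a $k$-regular graph on $n$ vertices and let $A$ denote its adjacency matrix. Then $\Gamma$ is closed distance magic if and only if there exists an eigenvector $v$ of $A$ with eigenvalue $-1$ such that a certain permutation of its entries results in the arithmetic sequence $$\frac{1-n}{2},\ \ldots,\ \frac{2i-1-n}{2},\ \ldots,\ \frac{n-1}{2}.$$ In particular, if $\Gamma$ is closed distance magic, then there exists an eigenvector of $A$ corresponding to the eigenvalue $-1$ for which all entries are pairwise distinct.
   Context: All graphs are finite, simple and undirected. For a vertex $u$, the closed neighborhood $N[u]$ consists of $u$ and all its neighbors. A closed distance magic labeling of a graph $\Gamma=(V,E)$ of order $n=|V|$ is a bijection $\ell:V\to\{1,2,\ldots,n\}$ for which there is a positive integer $r$ with $\sum_{x\in N[u]}\ell(x)=r$ for all $u\in V$. A graph is closed distance magic if it admits a closed distance magic labeling. Eigenvectors of $A$ are column vectors in $\mathbb{C}^n$ with entries indexed by $V$. In the arithmetic sequence, the $i$-th term is $\frac{2i-1-n}{2}$ for $1\le i\le n$.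
   Formalization: The formal theorem assumes that the graph has at least two vertices; for the one-vertex graph the claim is false, since it is closed distance magic but its adjacency matrix (0) has no eigenvalue -1 (and the empty graph fails likewise). -}

module Defs where

open import Algebra.Bundles using (CommutativeRing)
import Algebra.Definitions.RawMonoid as RawMonoid
import Algebra.Properties.Ring as RingProperties
import Algebra.Solver.Ring.NaturalCoefficients.Default as NaturalSolver
open import Data.Bool.Base using (if_then_else_)
open import Data.Fin.Base using (Fin; toℕ)
open import Data.Fin.Permutation using (Permutation′; _⟨$⟩ʳ_)
import Data.Fin.Properties as Fin
open import Data.Integer.Base using (+_) renaming (_-_ to _-ℤ_)
open import Data.List.Base using (List; length; map; filter; allFin; sum)
open import Data.Nat.Base as ℕ using (ℕ; suc)
import Data.Nat.Properties as ℕ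
open import Data.Product.Base using (∃-syntax; _×_; _,_; proj₁; proj₂)
open import Data.Rational.Base as ℚ
  using (ℚ; 0ℚ; 1ℚ; ½; _/_; ∣_∣; _<_; Positive; 1/_)
import Data.Rational.Properties as ℚ
open import Function.Bundles using (_⤖_; Bijection)
open import Level using (0ℓ)
open import Relation.Binary.Core using (Rel)
open import Relation.Binary.Definitions using (Decidable; Irreflexive; Symmetric)
open import Relation.Binary.PropositionalEquality.Core
  using (_≡_; _≢_; refl; sym; trans; cong; subst)
open import Relation.Nullary.Decidable using (does; _⊎-dec_)
open import Relation.Nullary.Negation using (¬_)

------------------------------------------------------------------------
-- The real numbers, as Cauchy sequences of rationals up to null sequences

Cauchy : (ℕ → ℚ) → Set
Cauchy x = ∀ ε → 0ℚ < ε →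
  ∃[ N ] (∀ m n → N ℕ.≤ m → N ℕ.≤ n → ∣ x m ℚ.- x n ∣ < ε)

record ℝ : Set where
  constructor mkℝ
  field
    seq    : ℕ → ℚ
    cauchy : Cauchy seq

open ℝ public

infix 4 _≈ℝ_
_≈ℝ_ : Rel ℝ 0ℓ
x ≈ℝ y = ∀ ε → 0ℚ < ε →
  ∃[ N ] (∀ n → N ℕ.≤ n → ∣ seq x n ℚ.- seq y n ∣ < ε)

private
  -- Ring identities are proved in an arbitrary commutative ring, so that
  -- the type checker unfolds neither rational arithmetic nor Cauchy sequences.
  module Differences (K : CommutativeRing 0ℓ 0ℓ) where
    open CommutativeRing K
      using (_≈_; _+_; _*_; -_; ring; commutativeSemiring; +-assoc; +-comm;
        +-identityʳ; +-cong; +-congˡ; +-congʳ; -‿cong; -‿inverseˡ; *-comm; distribˡ)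
      renaming (refl to ≈-refl; sym to ≈-sym; trans to ≈-trans)
    open RingProperties ring using (-‿involutive; -‿+-comm; -‿distribʳ-*)
    open NaturalSolver commutativeSemiring using (solve; _:+_; _:*_; _:=_)

    +-diff : ∀ a b c d → (a + - b) + (c + - d) ≈ (a + c) + - (b + d)
    +-diff a b c d =
      ≈-trans (interchange a (- b) c (- d)) (+-congˡ (-‿+-comm b d))
      where
      interchange : ∀ a b c d → (a + b) + (c + d) ≈ (a + c) + (b + d)
      interchange = solve 4 (λ a b c d →
          (a :+ b) :+ (c :+ d) := (a :+ c) :+ (b :+ d)) ≈-refl

    neg-diff : ∀ a b → - (a + - b) ≈ - a + - (- b)
    neg-diff a b = ≈-sym (-‿+-comm a (- b))

    swap-diff : ∀ a b → - (a + - b) ≈ b + - a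
    swap-diff a b = ≈-trans (neg-diff a b)
      (≈-trans (+-congˡ (-‿involutive b)) (+-comm (- a) b))

    split : ∀ a b → (a + - b) + b ≈ a
    split a b = ≈-trans (+-assoc a (- b) b)
      (≈-trans (+-congˡ (-‿inverseˡ b)) (+-identityʳ a))

    trans-diff : ∀ a b c → (a + - b) + (b + - c) ≈ a + - c
    trans-diff a b c = ≈-trans (≈-sym (+-assoc (a + - b) b (- c)))
      (+-congʳ (split a b))

    *-diff : ∀ a b c d → a * (c + - d) + d * (a + - b) ≈ a * c + - (b * d)
    *-diff a b c d =
      ≈-trans (+-cong (*-sub a c d) (≈-trans (*-sub d a b)
          (+-cong (*-comm d a) (-‿cong (*-comm d b)))))
        (trans-diff (a * c) (a * d) (b * d))
      where
      *-sub : ∀ x y z → x * (y + - z) ≈ x * y + - (x * z)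
      *-sub x y z = ≈-trans (distribˡ x y (- z)) (+-congˡ (≈-sym (-‿distribʳ-* x z)))

  open Differences ℚ.+-*-commutativeRing

  -- A family f of rationals indexed by I is small if ∣ f i ∣ is below any given
  -- ε from some stage on; P N i says that the index i lies beyond stage N.
  -- I = ℕ is used for ≈ℝ and I = ℕ × ℕ for Cauchy.
  module _ {I : Set} (P : ℕ → I → Set) where

    record Small (f : I → ℚ) : Set where
      constructor mkSmall
      field stage : ∀ ε → 0ℚ < ε → ∃[ N ] (∀ i → P N i → ∣ f i ∣ < ε)

    record Bounded (f : I → ℚ) : Set where
      constructor mkBounded
      field
        bound   : ℚ
        bound>0 : Positive bound
        from    : ℕ
        below   : ∀ i → P from i → ∣ f i ∣ < bound

  open Small
  open Bounded

  module _ {I : Set} {P : ℕ → I → Set} where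

    Small-cong : ∀ {f g} → (∀ i → f i ≡ g i) → Small P f → Small P g
    Small-cong f≡g s .stage ε ε>0 with s .stage ε ε>0
    ... | N , h = N , λ i p → subst (λ q → ∣ q ∣ < ε) (f≡g i) (h i p)

    Small-0 : ∀ {f} → (∀ i → f i ≡ 0ℚ) → Small P f
    Small-0 f≡0 .stage ε ε>0 =
      0 , λ i _ → subst (λ q → ∣ q ∣ < ε) (sym (f≡0 i)) ε>0

    Small-neg : ∀ {f} → Small P f → Small P (λ i → ℚ.- f i)
    Small-neg {f} s .stage ε ε>0 with s .stage ε ε>0
    ... | N , h = N , λ i p → subst (_< ε) (sym (ℚ.∣-p∣≡∣p∣ (f i))) (h i p)

    module _ (anti : ∀ {M N i} → M ℕ.≤ N → P N i → P M i) where

      Small-+ : ∀ {f g} → Small P f → Small P g → Small P (λ i → f i ℚ.+ g i)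
      Small-+ {f} {g} s t .stage ε ε>0 = M ℕ.⊔ N , λ i p →
        ℚ.≤-<-trans (ℚ.∣p+q∣≤∣p∣+∣q∣ (f i) (g i))
          (subst (∣ f i ∣ ℚ.+ ∣ g i ∣ <_) ½ε+½ε≡ε
            (ℚ.+-mono-< (h i (anti (ℕ.m≤m⊔n M N) p)) (k i (anti (ℕ.m≤n⊔m M N) p))))
        where
        ½ε>0 : 0ℚ < ½ ℚ.* ε
        ½ε>0 = subst (_< ½ ℚ.* ε) (ℚ.*-zeroʳ ½) (ℚ.*-monoʳ-<-pos ½ ε>0)
        ½ε+½ε≡ε : ½ ℚ.* ε ℚ.+ ½ ℚ.* ε ≡ ε
        ½ε+½ε≡ε = trans (sym (ℚ.*-distribʳ-+ ε ½ ½)) (ℚ.*-identityˡ ε)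
        M = proj₁ (s .stage _ ½ε>0)
        h = proj₂ (s .stage _ ½ε>0)
        N = proj₁ (t .stage _ ½ε>0)
        k = proj₂ (t .stage _ ½ε>0)

      Small-* : ∀ {f g} → Bounded P f → Small P g → Small P (λ i → f i ℚ.* g i)
      Small-* {f} {g} (mkBounded B B>0 M h) s .stage ε ε>0 = M ℕ.⊔ N , λ i p →
        subst (_< ε) (sym (ℚ.∣p*q∣≡∣p∣*∣q∣ (f i) (g i)))
          (ℚ.≤-<-trans
            (ℚ.*-monoʳ-≤-nonNeg ∣ g i ∣ {{ℚ.∣-∣-nonNeg (g i)}}
              (ℚ.<⇒≤ (h i (anti (ℕ.m≤m⊔n M N) p))))
            (subst (B ℚ.* ∣ g i ∣ <_) Bδ≡ε
              (ℚ.*-monoʳ-<-pos B (k i (anti (ℕ.m≤n⊔m M N) p)))))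
        where
        instance
          _ = B>0
          _ = ℚ.pos⇒nonZero B
          _ = ℚ.1/pos⇒pos B
        δ>0 : 0ℚ < 1/ B ℚ.* ε
        δ>0 = subst (_< 1/ B ℚ.* ε) (ℚ.*-zeroʳ (1/ B)) (ℚ.*-monoʳ-<-pos (1/ B) ε>0)
        Bδ≡ε : B ℚ.* (1/ B ℚ.* ε) ≡ ε
        Bδ≡ε = trans (sym (ℚ.*-assoc B (1/ B) ε))
          (trans (cong (ℚ._* ε) (ℚ.*-inverseʳ B)) (ℚ.*-identityˡ ε))
        N = proj₁ (s .stage _ δ>0)
        k = proj₂ (s .stage _ δ>0)

  Late : ℕ → ℕ → Set
  Late = ℕ._≤_

  Late₂ : ℕ → ℕ × ℕ → Set
  Late₂ N (m , n) = N ℕ.≤ m × N ℕ.≤ n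

  Late-anti : ∀ {M N i} → M ℕ.≤ N → Late N i → Late M i
  Late-anti = ℕ.≤-trans

  Late₂-anti : ∀ {M N i} → M ℕ.≤ N → Late₂ N i → Late₂ M i
  Late₂-anti M≤N (p , q) = ℕ.≤-trans M≤N p , ℕ.≤-trans M≤N q

  toCauchy : ∀ x → Small Late₂ (λ (m , n) → x m ℚ.- x n) → Cauchy x
  toCauchy x s ε ε>0 with s .stage ε ε>0
  ... | N , h = N , λ m n p q → h (m , n) (p , q)

  fromCauchy : ∀ x → Small Late₂ (λ (m , n) → seq x m ℚ.- seq x n)
  fromCauchy x .stage ε ε>0 with cauchy x ε ε>0
  ... | N , h = N , λ (m , n) (p , q) → h m n p q

  bounded : ∀ x → Bounded Late (seq x)
  bounded (mkℝ x c) with c 1ℚ (ℚ.positive⁻¹ 1ℚ)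
  ... | N , h = mkBounded (1ℚ ℚ.+ ∣ x N ∣)
    (ℚ.pos+nonNeg⇒pos 1ℚ ∣ x N ∣ {{ℚ.∣-∣-nonNeg (x N)}})
    N
    λ n p → ℚ.≤-<-trans
      (subst (λ q → ∣ q ∣ ℚ.≤ ∣ x n ℚ.- x N ∣ ℚ.+ ∣ x N ∣) (split (x n) (x N))
        (ℚ.∣p+q∣≤∣p∣+∣q∣ (x n ℚ.- x N) (x N)))
      (ℚ.+-monoˡ-< ∣ x N ∣ (h n N p ℕ.≤-refl))

  bounded₁ : ∀ x → Bounded Late₂ (λ (m , n) → seq x m)
  bounded₁ x with bounded x
  ... | mkBounded B B>0 N h = mkBounded B B>0 N λ (m , n) (p , q) → h m p

  bounded₂ : ∀ x → Bounded Late₂ (λ (m , n) → seq x n)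
  bounded₂ x with bounded x
  ... | mkBounded B B>0 N h = mkBounded B B>0 N λ (m , n) (p , q) → h n q

fromℚ : ℚ → ℝ
fromℚ q = mkℝ (λ _ → q) (toCauchy (λ _ → q) (Small-0 (λ _ → ℚ.+-inverseʳ q)))

infixl 6 _+ℝ_
_+ℝ_ : ℝ → ℝ → ℝ
x +ℝ y = mkℝ (λ n → seq x n ℚ.+ seq y n) (toCauchy (λ n → seq x n ℚ.+ seq y n)
  (Small-cong (λ (m , n) → +-diff (seq x m) (seq x n) (seq y m) (seq y n))
    (Small-+ Late₂-anti (fromCauchy x) (fromCauchy y))))

infixl 7 _*ℝ_
_*ℝ_ : ℝ → ℝ → ℝ
x *ℝ y = mkℝ (λ n → seq x n ℚ.* seq y n) (toCauchy (λ n → seq x n ℚ.* seq y n)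
  (Small-cong (λ (m , n) → *-diff (seq x m) (seq x n) (seq y m) (seq y n))
    (Small-+ Late₂-anti
      (Small-* Late₂-anti (bounded₁ x) (fromCauchy y))
      (Small-* Late₂-anti (bounded₂ y) (fromCauchy x)))))

infix 8 -ℝ_
-ℝ_ : ℝ → ℝ
-ℝ x = mkℝ (λ n → ℚ.- seq x n) (toCauchy (λ n → ℚ.- seq x n)
  (Small-cong (λ (m , n) → neg-diff (seq x m) (seq x n))
    (Small-neg (fromCauchy x))))

private
  from≈ : ∀ x y → x ≈ℝ y → Small Late (λ n → seq x n ℚ.- seq y n)
  from≈ x y p = mkSmall p

  pointwise : ∀ x y → (∀ n → seq x n ≡ seq y n) → x ≈ℝ y
  pointwise x y x≡y = Small-0
    (λ n → subst (λ q → q ℚ.- seq y n ≡ 0ℚ) (sym (x≡y n)) (ℚ.+-inverseʳ (seq y n)))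
    .stage

  ≈ℝ-sym : ∀ x y → x ≈ℝ y → y ≈ℝ x
  ≈ℝ-sym x y p = Small-cong (λ n → swap-diff (seq x n) (seq y n))
    (Small-neg (from≈ x y p)) .stage

  ≈ℝ-trans : ∀ x y z → x ≈ℝ y → y ≈ℝ z → x ≈ℝ z
  ≈ℝ-trans x y z p q =
    Small-cong (λ n → trans-diff (seq x n) (seq y n) (seq z n))
      (Small-+ Late-anti (from≈ x y p) (from≈ y z q)) .stage

  +ℝ-cong : ∀ x y u v → x ≈ℝ y → u ≈ℝ v → x +ℝ u ≈ℝ y +ℝ v
  +ℝ-cong x y u v p q =
    Small-cong (λ n → +-diff (seq x n) (seq y n) (seq u n) (seq v n))
      (Small-+ Late-anti (from≈ x y p) (from≈ u v q)) .stage

  *ℝ-cong : ∀ x y u v → x ≈ℝ y → u ≈ℝ v → x *ℝ u ≈ℝ y *ℝ v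
  *ℝ-cong x y u v p q =
    Small-cong (λ n → *-diff (seq x n) (seq y n) (seq u n) (seq v n))
      (Small-+ Late-anti
        (Small-* Late-anti (bounded x) (from≈ u v q))
        (Small-* Late-anti (bounded v) (from≈ x y p))) .stage

  -ℝ-cong : ∀ x y → x ≈ℝ y → -ℝ x ≈ℝ -ℝ y
  -ℝ-cong x y p = Small-cong (λ n → neg-diff (seq x n) (seq y n))
    (Small-neg (from≈ x y p)) .stage

ℝ-commutativeRing : CommutativeRing 0ℓ 0ℓ
ℝ-commutativeRing = record
  { Carrier = ℝ
  ; _≈_ = _≈ℝ_
  ; _+_ = _+ℝ_
  ; _*_ = _*ℝ_
  ; -_  = -ℝ_
  ; 0#  = fromℚ 0ℚ
  ; 1#  = fromℚ 1ℚ
  ; isCommutativeRing = record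
    { isRing = record
      { +-isAbelianGroup = record
        { isGroup = record
          { isMonoid = record
            { isSemigroup = record
              { isMagma = record
                { isEquivalence = record
                  { refl  = λ {x} → pointwise x x λ _ → refl
                  ; sym   = λ {x} {y} → ≈ℝ-sym x y
                  ; trans = λ {x} {y} {z} → ≈ℝ-trans x y z
                  }
                ; ∙-cong = λ {x} {y} {u} {v} → +ℝ-cong x y u v
                }
              ; assoc = λ x y z → pointwise ((x +ℝ y) +ℝ z) (x +ℝ (y +ℝ z))
                  λ n → ℚ.+-assoc (seq x n) (seq y n) (seq z n)
              }
            ; identity =
                (λ x → pointwise (fromℚ 0ℚ +ℝ x) x λ n → ℚ.+-identityˡ (seq x n))
              , (λ x → pointwise (x +ℝ fromℚ 0ℚ) x λ n → ℚ.+-identityʳ (seq x n))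
            }
          ; inverse =
              (λ x → pointwise (-ℝ x +ℝ x) (fromℚ 0ℚ) λ n → ℚ.+-inverseˡ (seq x n))
            , (λ x → pointwise (x +ℝ -ℝ x) (fromℚ 0ℚ) λ n → ℚ.+-inverseʳ (seq x n))
          ; ⁻¹-cong = λ {x} {y} → -ℝ-cong x y
          }
        ; comm = λ x y → pointwise (x +ℝ y) (y +ℝ x)
            λ n → ℚ.+-comm (seq x n) (seq y n)
        }
      ; *-cong = λ {x} {y} {u} {v} → *ℝ-cong x y u v
      ; *-assoc = λ x y z → pointwise ((x *ℝ y) *ℝ z) (x *ℝ (y *ℝ z))
          λ n → ℚ.*-assoc (seq x n) (seq y n) (seq z n)
      ; *-identity =
          (λ x → pointwise (fromℚ 1ℚ *ℝ x) x λ n → ℚ.*-identityˡ (seq x n))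
        , (λ x → pointwise (x *ℝ fromℚ 1ℚ) x λ n → ℚ.*-identityʳ (seq x n))
      ; distrib =
          (λ x y z → pointwise (x *ℝ (y +ℝ z)) (x *ℝ y +ℝ x *ℝ z)
            λ n → ℚ.*-distribˡ-+ (seq x n) (seq y n) (seq z n))
        , (λ x y z → pointwise ((y +ℝ z) *ℝ x) (y *ℝ x +ℝ z *ℝ x)
            λ n → ℚ.*-distribʳ-+ (seq x n) (seq y n) (seq z n))
      }
    ; *-comm = λ x y → pointwise (x *ℝ y) (y *ℝ x)
        λ n → ℚ.*-comm (seq x n) (seq y n)
    }
  }

------------------------------------------------------------------------
-- The complex numbers

record ℂ : Set where
  constructor _+i_
  field
    re : ℝ
    im : ℝ

open ℂ public

infix 4 _≈ℂ_
_≈ℂ_ : Rel ℂ 0ℓ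
z ≈ℂ w = re z ≈ℝ re w × im z ≈ℝ im w

infixl 6 _+ℂ_
_+ℂ_ : ℂ → ℂ → ℂ
z +ℂ w = (re z +ℝ re w) +i (im z +ℝ im w)

infixl 7 _*ℂ_
_*ℂ_ : ℂ → ℂ → ℂ
z *ℂ w = (re z *ℝ re w +ℝ -ℝ (im z *ℝ im w)) +i (re z *ℝ im w +ℝ im z *ℝ re w)

infix 8 -ℂ_
-ℂ_ : ℂ → ℂ
-ℂ z = (-ℝ re z) +i (-ℝ im z)

ℚ→ℂ : ℚ → ℂ
ℚ→ℂ q = fromℚ q +i fromℚ 0ℚ

private
  module R = CommutativeRing ℝ-commutativeRing

  -- Negation is written as multiplication by m = - 1# so that the identities
  -- become ones about commutative semirings.
  module Identities (K : CommutativeRing 0ℓ 0ℓ) where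
    open CommutativeRing K
      using (Carrier; _≈_; _+_; _*_; -_; 0#; 1#; ring; commutativeSemiring;
        +-cong; +-congˡ; +-congʳ; +-identityʳ; *-comm; *-congˡ; *-congʳ;
        *-identityˡ; zeroˡ; -‿cong)
      renaming (refl to ≈-refl; sym to ≈-sym; trans to ≈-trans)
    open RingProperties ring using (-1*x≈-x; -0#≈0#)
    open NaturalSolver commutativeSemiring using (solve; _:+_; _:*_; _:=_)

    private
      m : Carrier
      m = - 1#

      sub : ∀ x y → x + - y ≈ x + m * y
      sub x y = +-congˡ (≈-sym (-1*x≈-x y))

    assoc-re : ∀ a b c d e f →
      (a * c + - (b * d)) * e + - ((a * d + b * c) * f)
        ≈ a * (c * e + - (d * f)) + - (b * (c * f + d * e))
    assoc-re a b c d e f =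
      ≈-trans (≈-trans (sub _ _) (+-congʳ (*-congʳ (sub _ _))))
        (≈-trans (identity m a b c d e f)
          (≈-sym (≈-trans (sub _ _) (+-congʳ (*-congˡ (sub _ _))))))
      where
      identity : ∀ m a b c d e f →
        (a * c + m * (b * d)) * e + m * ((a * d + b * c) * f)
          ≈ a * (c * e + m * (d * f)) + m * (b * (c * f + d * e))
      identity = solve 7 (λ m a b c d e f →
          (a :* c :+ m :* (b :* d)) :* e :+ m :* ((a :* d :+ b :* c) :* f)
          := a :* (c :* e :+ m :* (d :* f)) :+ m :* (b :* (c :* f :+ d :* e))) ≈-refl

    assoc-im : ∀ a b c d e f →
      (a * c + - (b * d)) * f + (a * d + b * c) * e
        ≈ a * (c * f + d * e) + b * (c * e + - (d * f))
    assoc-im a b c d e f =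
      ≈-trans (+-congʳ (*-congʳ (sub _ _)))
        (≈-trans (identity m a b c d e f) (≈-sym (+-congˡ (*-congˡ (sub _ _)))))
      where
      identity : ∀ m a b c d e f →
        (a * c + m * (b * d)) * f + (a * d + b * c) * e
          ≈ a * (c * f + d * e) + b * (c * e + m * (d * f))
      identity = solve 7 (λ m a b c d e f →
          (a :* c :+ m :* (b :* d)) :* f :+ (a :* d :+ b :* c) :* e
          := a :* (c :* f :+ d :* e) :+ b :* (c :* e :+ m :* (d :* f))) ≈-refl

    distribˡ-re : ∀ a b c d e f →
      a * (c + e) + - (b * (d + f))
        ≈ (a * c + - (b * d)) + (a * e + - (b * f))
    distribˡ-re a b c d e f =
      ≈-trans (sub _ _)
        (≈-trans (identity m a b c d e f) (≈-sym (+-cong (sub _ _) (sub _ _))))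
      where
      identity : ∀ m a b c d e f →
        a * (c + e) + m * (b * (d + f))
          ≈ (a * c + m * (b * d)) + (a * e + m * (b * f))
      identity = solve 7 (λ m a b c d e f →
          a :* (c :+ e) :+ m :* (b :* (d :+ f))
          := (a :* c :+ m :* (b :* d)) :+ (a :* e :+ m :* (b :* f))) ≈-refl

    distribˡ-im : ∀ a b c d e f →
      a * (d + f) + b * (c + e) ≈ (a * d + b * c) + (a * f + b * e)
    distribˡ-im = solve 6 (λ a b c d e f →
        a :* (d :+ f) :+ b :* (c :+ e) := (a :* d :+ b :* c) :+ (a :* f :+ b :* e)) ≈-refl

    comm-re : ∀ a b c d → a * c + - (b * d) ≈ c * a + - (d * b)
    comm-re a b c d = +-cong (*-comm a c) (-‿cong (*-comm b d))

    comm-im : ∀ a b c d → a * d + b * c ≈ c * b + d * a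
    comm-im = solve 4 (λ a b c d →
        a :* d :+ b :* c := c :* b :+ d :* a) ≈-refl

    identityˡ-re : ∀ a b → 1# * a + - (0# * b) ≈ a
    identityˡ-re a b =
      ≈-trans (+-cong (*-identityˡ a) (≈-trans (-‿cong (zeroˡ b)) -0#≈0#)) (+-identityʳ a)

    identityˡ-im : ∀ a b → 1# * b + 0# * a ≈ b
    identityˡ-im a b = ≈-trans (+-cong (*-identityˡ b) (zeroˡ a)) (+-identityʳ b)

  module Id = Identities ℝ-commutativeRing

  ≈ℂ-trans : ∀ {x y z} → x ≈ℂ y → y ≈ℂ z → x ≈ℂ z
  ≈ℂ-trans {x} {y} {z} (p , q) (r , s) =
    R.trans {re x} {re y} {re z} p r , R.trans {im x} {im y} {im z} q s

  +ℂ-cong : ∀ {x y u v} → x ≈ℂ y → u ≈ℂ v → x +ℂ u ≈ℂ y +ℂ v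
  +ℂ-cong {x} {y} {u} {v} (p , q) (r , s) =
      R.+-cong {re x} {re y} {re u} {re v} p r
    , R.+-cong {im x} {im y} {im u} {im v} q s

  *ℂ-cong : ∀ {x y u v} → x ≈ℂ y → u ≈ℂ v → x *ℂ u ≈ℂ y *ℂ v
  *ℂ-cong {a +i b} {c +i d} {e +i f} {g +i h} (p , q) (r , s) =
      R.+-cong {a *ℝ e} {c *ℝ g} { -ℝ (b *ℝ f)} { -ℝ (d *ℝ h)}
        (R.*-cong {a} {c} {e} {g} p r)
        (R.-‿cong {b *ℝ f} {d *ℝ h} (R.*-cong {b} {d} {f} {h} q s))
    , R.+-cong {a *ℝ f} {c *ℝ h} {b *ℝ e} {d *ℝ g}
        (R.*-cong {a} {c} {f} {h} p s)
        (R.*-cong {b} {d} {e} {g} q r)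

  *ℂ-comm : ∀ x y → x *ℂ y ≈ℂ y *ℂ x
  *ℂ-comm (a +i b) (c +i d) = Id.comm-re a b c d , Id.comm-im a b c d

  *ℂ-identityˡ : ∀ x → ℚ→ℂ 1ℚ *ℂ x ≈ℂ x
  *ℂ-identityˡ (a +i b) = Id.identityˡ-re a b , Id.identityˡ-im a b

  *ℂ-distribˡ : ∀ x y z → x *ℂ (y +ℂ z) ≈ℂ x *ℂ y +ℂ x *ℂ z
  *ℂ-distribˡ (a +i b) (c +i d) (e +i f) =
    Id.distribˡ-re a b c d e f , Id.distribˡ-im a b c d e f

ℂ-commutativeRing : CommutativeRing 0ℓ 0ℓ
ℂ-commutativeRing = record
  { Carrier = ℂ
  ; _≈_ = _≈ℂ_
  ; _+_ = _+ℂ_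
  ; _*_ = _*ℂ_
  ; -_  = -ℂ_
  ; 0#  = ℚ→ℂ 0ℚ
  ; 1#  = ℚ→ℂ 1ℚ
  ; isCommutativeRing = record
    { isRing = record
      { +-isAbelianGroup = record
        { isGroup = record
          { isMonoid = record
            { isSemigroup = record
              { isMagma = record
                { isEquivalence = record
                  { refl  = λ {x} → R.refl {re x} , R.refl {im x}
                  ; sym   = λ {x} {y} (p , q) →
                      R.sym {re x} {re y} p , R.sym {im x} {im y} q
                  ; trans = λ {x} {y} {z} → ≈ℂ-trans {x} {y} {z}
                  }
                ; ∙-cong = λ {x} {y} {u} {v} → +ℂ-cong {x} {y} {u} {v}
                }
              ; assoc = λ x y z →
                  R.+-assoc (re x) (re y) (re z) , R.+-assoc (im x) (im y) (im z)
              }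
            ; identity =
                (λ x → R.+-identityˡ (re x) , R.+-identityˡ (im x))
              , (λ x → R.+-identityʳ (re x) , R.+-identityʳ (im x))
            }
          ; inverse =
              (λ x → R.-‿inverseˡ (re x) , R.-‿inverseˡ (im x))
            , (λ x → R.-‿inverseʳ (re x) , R.-‿inverseʳ (im x))
          ; ⁻¹-cong = λ {x} {y} (p , q) →
              R.-‿cong {re x} {re y} p , R.-‿cong {im x} {im y} q
          }
        ; comm = λ x y → R.+-comm (re x) (re y) , R.+-comm (im x) (im y)
        }
      ; *-cong = λ {x} {y} {u} {v} → *ℂ-cong {x} {y} {u} {v}
      ; *-assoc = λ (a +i b) (c +i d) (e +i f) →
          Id.assoc-re a b c d e f , Id.assoc-im a b c d e f
      ; *-identity =
          *ℂ-identityˡ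
        , (λ x → ≈ℂ-trans {x *ℂ ℚ→ℂ 1ℚ} {ℚ→ℂ 1ℚ *ℂ x} {x}
            (*ℂ-comm x (ℚ→ℂ 1ℚ)) (*ℂ-identityˡ x))
      ; distrib =
          *ℂ-distribˡ
        , (λ x y z →
            ≈ℂ-trans {(y +ℂ z) *ℂ x} {x *ℂ (y +ℂ z)} {y *ℂ x +ℂ z *ℂ x}
              (*ℂ-comm (y +ℂ z) x)
              (≈ℂ-trans {x *ℂ (y +ℂ z)} {x *ℂ y +ℂ x *ℂ z} {y *ℂ x +ℂ z *ℂ x}
                (*ℂ-distribˡ x y z)
                (+ℂ-cong {x *ℂ y} {y *ℂ x} {x *ℂ z} {z *ℂ x}
                  (*ℂ-comm x y) (*ℂ-comm x z))))
      }
    ; *-comm = *ℂ-comm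
    }
  }

------------------------------------------------------------------------
-- Matrices and eigenvectors over ℂ

open CommutativeRing ℂ-commutativeRing public using ()
  renaming (0# to 0ℂ; 1# to 1ℂ)

open RawMonoid (CommutativeRing.+-rawMonoid ℂ-commutativeRing) public using ()
  renaming (sum to ∑ℂ)

Vectorℂ : ℕ → Set
Vectorℂ n = Fin n → ℂ

Matrixℂ : ℕ → Set
Matrixℂ n = Fin n → Fin n → ℂ

infixr 7 _*ᵥ_
_*ᵥ_ : ∀ {n} → Matrixℂ n → Vectorℂ n → Vectorℂ n
(M *ᵥ v) u = ∑ℂ (λ w → M u w *ℂ v w)

IsEigenvector : ∀ {n} → Matrixℂ n → ℂ → Vectorℂ n → Set
IsEigenvector M μ v =
  ¬ (∀ u → v u ≈ℂ 0ℂ) × (∀ u → (M *ᵥ v) u ≈ℂ μ *ℂ v u)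

PairwiseDistinct : ∀ {n} → Vectorℂ n → Set
PairwiseDistinct v = ∀ u w → u ≢ w → ¬ (v u ≈ℂ v w)

------------------------------------------------------------------------
-- Graphs of order n, with vertex set Fin n

record Graph (n : ℕ) : Set₁ where
  infix 4 _~_ _~?_
  field
    _~_      : Rel (Fin n) 0ℓ
    _~?_     : Decidable _~_
    ~-sym    : Symmetric _~_
    ~-irrefl : Irreflexive _≡_ _~_

  neighbors : Fin n → List (Fin n)
  neighbors u = filter (u ~?_) (allFin n)

  N[_] : Fin n → List (Fin n)
  N[ u ] = filter (λ x → (u Fin.≟ x) ⊎-dec (u ~? x)) (allFin n)

Regular : ∀ {n} → ℕ → Graph n → Set
Regular k Γ = ∀ u → length (Graph.neighbors Γ u) ≡ k

adjacencyMatrix : ∀ {n} → Graph n → Matrixℂ n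
adjacencyMatrix Γ u w = if does (Graph._~?_ Γ u w) then 1ℂ else 0ℂ

-- The label set {1, …, n} is encoded as Fin n, with i standing for toℕ i + 1.
label : ∀ {n} → Fin n ⤖ Fin n → Fin n → ℕ
label ℓ x = suc (toℕ (Bijection.to ℓ x))

IsClosedDistanceMagicLabeling : ∀ {n} → Graph n → Fin n ⤖ Fin n → Set
IsClosedDistanceMagicLabeling Γ ℓ =
  ∃[ r ] (0 ℕ.< r × (∀ u → sum (map (label ℓ) (Graph.N[_] Γ u)) ≡ r))

ClosedDistanceMagic : ∀ {n} → Graph n → Set
ClosedDistanceMagic {n} Γ =
  ∃[ ℓ ] IsClosedDistanceMagicLabeling Γ ℓ

-- The term (2i − 1 − n) / 2 for i = toℕ j + 1.
arithmeticTerm : ∀ n → Fin n → ℚ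
arithmeticTerm n j = (+ (2 ℕ.* suc (toℕ j)) -ℤ + 1 -ℤ + n) / 2

PermutesToArithmetic : ∀ {n} → Vectorℂ n → Set
PermutesToArithmetic {n} v =
  ∃[ σ ] (∀ j → v (σ ⟨$⟩ʳ j) ≈ℂ ℚ→ℂ (arithmeticTerm n j))

{-# OPTIONS --safe #-}

-- Centring the labels 1, …, n at their mean turns a labeling into the vector
-- v = (2ℓ − 1 − n) / 2, and (A v)(u) = − v(u) says that the sum of v over the
-- closed neighbourhood N[u] vanishes. By regularity centring changes every
-- closed neighbourhood sum by the same amount, so the sums of ℓ are constant
-- iff those of v are. If they are constant, the constant is 0: summed over all
-- u they give (k + 1) ∑ v, and ∑ v = 0 because the arithmetic sequence is
-- antisymmetric.
module Submission where

open import Algebra.Bundles using (CommutativeMonoid; CommutativeRing)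
open import Algebra.Core using (Op₁; Op₂)
import Algebra.Definitions.RawMonoid as RawMonoid
open import Algebra.Morphism.Structures using (IsMonoidHomomorphism; IsMonoidMonomorphism)
import Algebra.Properties.AbelianGroup as AbelianGroupProperties
import Algebra.Properties.CommutativeMonoid.Mult as Mult
import Algebra.Properties.CommutativeMonoid.Sum as Sum
import Algebra.Properties.Ring as RingProperties
open import Algebra.Structures using (IsCommutativeRing)
open import Data.Bool.Base using (Bool; true; false; if_then_else_)
open import Data.Fin.Base using (Fin; zero; suc; toℕ; fromℕ<; opposite)
open import Data.Fin.Permutation as Perm using (Permutation′; _⟨$⟩ʳ_; _⟨$⟩ˡ_)
import Data.Fin.Properties as Fin
open import Data.Integer.Base as ℤ using (ℤ; +_; 0ℤ)
import Data.Integer.Properties as ℤ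
open import Data.Integer.Tactic.RingSolver as ℤ-Tactic using ()
open import Data.List.Base using (map; length; filter; tabulate)
open import Data.Nat.Base as ℕ using (ℕ; zero; suc; _≤_)
import Data.Nat.ListAction as List
import Data.Nat.Properties as ℕ
open import Data.Product.Base using (_×_; ∃-syntax; _,_)
open import Data.Rational.Base as ℚ using (0ℚ)
import Data.Rational.Properties as ℚ
open import Data.Rational.Unnormalised.Base as ℚᵘ using (mkℚᵘ)
import Data.Rational.Unnormalised.Properties as ℚᵘ
open import Data.Sum.Base using (inj₁; inj₂)
open import Function.Base using (_∘_; id)
open import Function.Bundles using (_⇔_; mk⇔; _⤖_; Bijection)
open import Function.Properties.Bijection using (⤖⇒↔)
open import Function.Properties.Inverse using (↔⇒⤖)
open import Relation.Binary.Core using (Rel)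
open import Relation.Binary.PropositionalEquality
  using (_≡_; refl; sym; trans; cong; cong₂; subst; module ≡-Reasoning)
open import Relation.Nullary.Decidable using (does; yes; no; _⊎-dec_)
open import Relation.Nullary.Negation using (¬_; contradiction)
open import Relation.Unary using (Pred; Decidable)
open import Defs

count : ∀ {n} → (Fin n → Bool) → ℕ
count b = RawMonoid.sum ℕ.+-0-rawMonoid (λ i → if b i then 1 else 0)

module NeighborhoodSums {c ℓ} (M : CommutativeMonoid c ℓ) where

  open CommutativeMonoid M
    renaming (_∙_ to _+_; ε to 0#; ∙-cong to +-cong; ∙-congˡ to +-congˡ;
      identityˡ to +-identityˡ; refl to ≈-refl; sym to ≈-sym; trans to ≈-trans;
      reflexive to ≈-reflexive)
  open Sum M public
  open Mult M public using () renaming (_×_ to _·_; ×-congʳ to ·-congʳ; ×-congˡ to ·-congˡ)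
  open import Relation.Binary.Reasoning.Setoid setoid

  restrict : ∀ {n} → (Fin n → Bool) → (Fin n → Carrier) → Fin n → Carrier
  restrict b f i = if b i then f i else 0#

  if-cong : ∀ b {x y} → x ≈ y → (if b then x else 0#) ≈ (if b then y else 0#)
  if-cong true  x≈y = x≈y
  if-cong false _   = ≈-refl

  if-+ : ∀ b x y → (if b then x + y else 0#)
    ≈ (if b then x else 0#) + (if b then y else 0#)
  if-+ true  x y = ≈-refl
  if-+ false x y = ≈-sym (+-identityˡ 0#)

  sum-if-const : ∀ {n} (b : Fin n → Bool) x →
    sum (restrict b (λ _ → x)) ≈ count b · x
  sum-if-const {zero}  b x = ≈-refl
  sum-if-const {suc n} b x with b zero | sum-if-const (b ∘ suc) x
  ... | true  | ih = +-congˡ ih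
  ... | false | ih = ≈-trans (+-identityˡ _) ih

  sum-· : ∀ {n} k (f : Fin n → Carrier) → sum (λ i → k · f i) ≈ k · sum f
  sum-· {n} zero    f = sum-replicate-zero n
  sum-· {n} (suc k) f = ≈-trans (∑-distrib-+ f (λ i → k · f i)) (+-congˡ (sum-· k f))

  module _ {n} (adj : Fin n → Fin n → Bool) where

    closedSum : (Fin n → Carrier) → Fin n → Carrier
    closedSum f u = f u + sum (restrict (adj u) f)

    closedSum-cong : ∀ {f g} → (∀ w → f w ≈ g w) → ∀ u → closedSum f u ≈ closedSum g u
    closedSum-cong f≈g u =
      +-cong (f≈g u) (sum-cong-≋ λ w → if-cong (adj u w) (f≈g w))

    closedSum-+ : ∀ f g u → closedSum (λ w → f w + g w) u ≈ closedSum f u + closedSum g u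
    closedSum-+ f g u = begin
      (f u + g u) + sum (restrict (adj u) (λ w → f w + g w))
        ≈⟨ +-congˡ (sum-cong-≋ λ w → if-+ (adj u w) (f w) (g w)) ⟩
      (f u + g u) + sum (λ w → restrict (adj u) f w + restrict (adj u) g w)
        ≈⟨ +-congˡ (∑-distrib-+ (restrict (adj u) f) (restrict (adj u) g)) ⟩
      (f u + g u) + (sum (restrict (adj u) f) + sum (restrict (adj u) g))
        ≈⟨ interchange _ _ _ _ ⟩
      closedSum f u + closedSum g u ∎
      where
      open import Algebra.Properties.CommutativeSemigroup commutativeSemigroup
        using (interchange)

    module _ {k} (regular : ∀ u → count (adj u) ≡ k) where

      closedSum-const : ∀ x u → closedSum (λ _ → x) u ≈ suc k · x
      closedSum-const x u = +-congˡ (≈-trans (sum-if-const (adj u) x) (·-congˡ (regular u)))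

      sum-closedSum : (∀ u w → adj u w ≡ adj w u) → ∀ f → sum (closedSum f) ≈ suc k · sum f
      sum-closedSum adj-sym f = begin
        sum (closedSum f)
          ≈⟨ ∑-distrib-+ f _ ⟩
        sum f + sum (λ u → sum (restrict (adj u) f))
          ≈⟨ +-congˡ (∑-comm (λ u w → if adj u w then f w else 0#)) ⟩
        sum f + sum (λ w → sum (λ u → if adj u w then f w else 0#))
          ≈⟨ +-congˡ (sum-cong-≋ λ w → sum-cong-≋ λ u →
               ≈-reflexive (cong (if_then f w else 0#) (adj-sym u w))) ⟩
        sum f + sum (λ w → sum (λ u → if adj w u then f w else 0#))
          ≈⟨ +-congˡ (sum-cong-≋ λ w →
               ≈-trans (sum-if-const (adj w) (f w)) (·-congˡ (regular w))) ⟩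
        sum f + sum (λ w → k · f w)
          ≈⟨ +-congˡ (sum-· k f) ⟩
        suc k · sum f ∎

module _ {a b c d} {M : CommutativeMonoid a b} {N : CommutativeMonoid c d} where

  private
    module M = CommutativeMonoid M
    module N = CommutativeMonoid N
    module SM = NeighborhoodSums M
    module SN = NeighborhoodSums N

  module _ {φ : M.Carrier → N.Carrier} (φ-hom : IsMonoidHomomorphism M.rawMonoid N.rawMonoid φ) where

    open IsMonoidHomomorphism φ-hom

    sum-homo : ∀ {n} (f : Fin n → M.Carrier) → φ (SM.sum f) N.≈ SN.sum (φ ∘ f)
    sum-homo {zero}  f = ε-homo
    sum-homo {suc n} f = N.trans (homo _ _) (N.∙-congˡ (sum-homo (f ∘ suc)))

    if-homo : ∀ b x → φ (if b then x else M.ε) N.≈ (if b then φ x else N.ε)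
    if-homo true  x = N.refl
    if-homo false x = ε-homo

    closedSum-homo : ∀ {n} (adj : Fin n → Fin n → Bool) f u →
      φ (SM.closedSum adj f u) N.≈ SN.closedSum adj (φ ∘ f) u
    closedSum-homo adj f u = N.trans (homo _ _)
      (N.∙-congˡ (N.trans (sum-homo (SM.restrict (adj u) f))
        (SN.sum-cong-≋ λ w → if-homo (adj u w) (f w))))

open NeighborhoodSums ℕ.+-0-commutativeMonoid using ()
  renaming (closedSum to closedSumℕ; sum to sumℕ; restrict to restrictℕ)
open NeighborhoodSums ℤ.+-0-commutativeMonoid using ()
  renaming (closedSum to closedSumℤ; sum to sumℤ)

sum-map-filter : ∀ {a p n} {A : Set a} {P : Pred A p} (P? : Decidable P)
  (f : A → ℕ) (g : Fin n → A) →
  List.sum (map f (filter P? (tabulate g))) ≡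
    sumℕ (restrictℕ (does ∘ P? ∘ g) (f ∘ g))
sum-map-filter {n = zero}  P? f g = refl
sum-map-filter {n = suc n} P? f g with does (P? (g zero))
... | true  = cong (f (g zero) ℕ.+_) (sum-map-filter P? f (g ∘ suc))
... | false = sum-map-filter P? f (g ∘ suc)

length-filter-tabulate : ∀ {a p n} {A : Set a} {P : Pred A p} (P? : Decidable P)
  (g : Fin n → A) → length (filter P? (tabulate g)) ≡ count (does ∘ P? ∘ g)
length-filter-tabulate {n = zero}  P? g = refl
length-filter-tabulate {n = suc n} P? g with does (P? (g zero))
... | true  = cong suc (length-filter-tabulate P? (g ∘ suc))
... | false = length-filter-tabulate P? (g ∘ suc)

sum-if-≟ : ∀ {n} (u : Fin n) (f : Fin n → ℕ) →
  sumℕ (restrictℕ (does ∘ (u Fin.≟_)) f) ≡ f u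
sum-if-≟ {suc n} zero f = trans
  (cong (f zero ℕ.+_) (NeighborhoodSums.sum-replicate-zero ℕ.+-0-commutativeMonoid n))
  (ℕ.+-identityʳ (f zero))
sum-if-≟ {suc n} (suc u) f = sum-if-≟ u (f ∘ suc)

module _ {n} (Γ : Graph n) where

  open Graph Γ

  adjacent : Fin n → Fin n → Bool
  adjacent u w = does (u ~? w)

  adjacent-sym : ∀ u w → adjacent u w ≡ adjacent w u
  adjacent-sym u w with u ~? w | w ~? u
  ... | yes _ | yes _ = refl
  ... | yes p | no ¬q = contradiction (~-sym p) ¬q
  ... | no ¬p | yes q = contradiction (~-sym q) ¬p
  ... | no _  | no _  = refl

  sum-N[] : ∀ f u → List.sum (map f N[ u ]) ≡ closedSumℕ adjacent f u
  sum-N[] f u = begin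
    List.sum (map f N[ u ])
      ≡⟨ sum-map-filter (λ x → (u Fin.≟ x) ⊎-dec (u ~? x)) f id ⟩
    sumℕ (restrictℕ (λ x → does ((u Fin.≟ x) ⊎-dec (u ~? x))) f)
      ≡⟨ S.sum-cong-≋ disjoint ⟩
    sumℕ (λ x → restrictℕ (does ∘ (u Fin.≟_)) f x ℕ.+ restrictℕ (adjacent u) f x)
      ≡⟨ S.∑-distrib-+ (restrictℕ (does ∘ (u Fin.≟_)) f) (restrictℕ (adjacent u) f) ⟩
    sumℕ (restrictℕ (does ∘ (u Fin.≟_)) f) ℕ.+ sumℕ (restrictℕ (adjacent u) f)
      ≡⟨ cong (ℕ._+ sumℕ (restrictℕ (adjacent u) f)) (sum-if-≟ u f) ⟩
    closedSumℕ adjacent f u ∎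
    where
    open ≡-Reasoning
    module S = NeighborhoodSums ℕ.+-0-commutativeMonoid
    disjoint : ∀ x → restrictℕ (λ x → does ((u Fin.≟ x) ⊎-dec (u ~? x))) f x ≡
      restrictℕ (does ∘ (u Fin.≟_)) f x ℕ.+ restrictℕ (adjacent u) f x
    disjoint x with u Fin.≟ x | u ~? x
    ... | yes p | yes q = contradiction q (~-irrefl p)
    ... | yes _ | no _  = sym (ℕ.+-identityʳ (f x))
    ... | no _  | yes _ = refl
    ... | no _  | no _  = refl

·-ℤ : ∀ m i → RawMonoid._×_ ℤ.+-0-rawMonoid m i ≡ + m ℤ.* i
·-ℤ zero    i = sym (ℤ.*-zeroˡ i)
·-ℤ (suc m) i = trans (cong (λ x → i ℤ.+ x) (·-ℤ m i)) (sym (ℤ.suc-* (+ m) i))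

-- Twice the arithmetic term, which keeps the counting argument in ℤ.
centered : ∀ n → Fin n → ℤ
centered n j = + (2 ℕ.* suc (toℕ j)) ℤ.- + 1 ℤ.- + n

centered-label : ∀ n j → + (2 ℕ.* suc (toℕ j)) ≡ centered n j ℤ.+ + suc n
centered-label n j = ring (+ (2 ℕ.* suc (toℕ j))) (+ n)
  where
  ring : ∀ x y → x ≡ x ℤ.- + 1 ℤ.- y ℤ.+ (+ 1 ℤ.+ y)
  ring = ℤ-Tactic.solve-∀

centered-injective : ∀ n {i j} → centered n i ≡ centered n j → i ≡ j
centered-injective n {i} {j} eq = Fin.toℕ-injective (ℕ.suc-injective
  (ℕ.*-cancelˡ-≡ _ _ 2 (ℤ.+-injective (trans (centered-label n i)
    (trans (cong (ℤ._+ + suc n) eq) (sym (centered-label n j)))))))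

centered-opposite : ∀ n j → centered n (opposite j) ≡ ℤ.- centered n j
centered-opposite n j = begin
  + (2 ℕ.* suc (toℕ (opposite j))) ℤ.- + 1 ℤ.- + n
    ≡⟨ cong₂ (λ x y → x ℤ.- + 1 ℤ.- + y) (ℤ.pos-* 2 (suc o)) n≡ ⟩
  + 2 ℤ.* (+ 1 ℤ.+ + o) ℤ.- + 1 ℤ.- (+ o ℤ.+ + suc (toℕ j))
    ≡⟨ ring (+ o) (+ suc (toℕ j)) ⟩
  ℤ.- (+ 2 ℤ.* + suc (toℕ j) ℤ.- + 1 ℤ.- (+ o ℤ.+ + suc (toℕ j)))
    ≡⟨ cong₂ (λ x y → ℤ.- (x ℤ.- + 1 ℤ.- + y)) (ℤ.pos-* 2 (suc (toℕ j))) n≡ ⟨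
  ℤ.- centered n j ∎
  where
  open ≡-Reasoning
  o = toℕ (opposite j)
  n≡ : n ≡ o ℕ.+ suc (toℕ j)
  n≡ = sym (trans (cong (ℕ._+ suc (toℕ j)) (Fin.opposite-prop j)) (ℕ.m∸n+n≡m (Fin.toℕ<n j)))
  ring : ∀ x y → + 2 ℤ.* (+ 1 ℤ.+ x) ℤ.- + 1 ℤ.- (x ℤ.+ y) ≡
    ℤ.- (+ 2 ℤ.* y ℤ.- + 1 ℤ.- (x ℤ.+ y))
  ring = ℤ-Tactic.solve-∀

sum-centered : ∀ n → sumℤ (centered n) ≡ 0ℤ
sum-centered n with ℤ.i*j≡0⇒i≡0∨j≡0 (+ 2) 2s≡0
  where
  open ≡-Reasoning
  module S = NeighborhoodSums ℤ.+-0-commutativeMonoid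
  s = sumℤ (centered n)
  2s≡0 : + 2 ℤ.* s ≡ 0ℤ
  2s≡0 = begin
    + 2 ℤ.* s
      ≡⟨ ·-ℤ 2 s ⟨
    s ℤ.+ (s ℤ.+ 0ℤ)
      ≡⟨ cong (λ x → s ℤ.+ x) (trans (ℤ.+-identityʳ s)
           (S.sum-permute (centered n) Perm.reverse)) ⟩
    s ℤ.+ sumℤ (λ j → centered n (opposite j))
      ≡⟨ S.∑-distrib-+ (centered n) _ ⟨
    sumℤ (λ j → centered n j ℤ.+ centered n (opposite j))
      ≡⟨ S.sum-cong-≋ (λ j → trans (cong (λ x → centered n j ℤ.+ x) (centered-opposite n j))
           (ℤ.+-inverseʳ (centered n j))) ⟩
    sumℤ {n} (λ _ → 0ℤ)
      ≡⟨ S.sum-replicate-zero n ⟩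
    0ℤ ∎
... | inj₂ s≡0 = s≡0

double-homo : IsMonoidHomomorphism ℕ.+-0-rawMonoid ℤ.+-0-rawMonoid (λ m → + (2 ℕ.* m))
double-homo = record
  { isMagmaHomomorphism = record
    { isRelHomomorphism = record { cong = cong (λ m → + (2 ℕ.* m)) }
    ; homo = λ x y → cong +_ (ℕ.*-distribˡ-+ 2 x y)
    }
  ; ε-homo = refl
  }

module _ {n k} (Γ : Graph n) (Γ-regular : Regular k Γ) where

  private
    adj = adjacent Γ
    module S = NeighborhoodSums ℤ.+-0-commutativeMonoid

  adjacent-regular : ∀ u → count (adj u) ≡ k
  adjacent-regular u = trans (sym (length-filter-tabulate (Graph._~?_ Γ u) id)) (Γ-regular u)

  double-closedSum : (p : Fin n → Fin n) → ∀ u →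
    + (2 ℕ.* closedSumℕ adj (λ x → suc (toℕ (p x))) u) ≡
      closedSumℤ adj (centered n ∘ p) u ℤ.+ (suc k S.· (+ suc n))
  double-closedSum p u = begin
    + (2 ℕ.* closedSumℕ adj (λ x → suc (toℕ (p x))) u)
      ≡⟨ closedSum-homo {M = ℕ.+-0-commutativeMonoid} {N = ℤ.+-0-commutativeMonoid}
           double-homo adj (λ x → suc (toℕ (p x))) u ⟩
    closedSumℤ adj (λ x → + (2 ℕ.* suc (toℕ (p x)))) u
      ≡⟨ S.closedSum-cong adj (λ x → centered-label n (p x)) u ⟩
    closedSumℤ adj (λ x → centered n (p x) ℤ.+ + suc n) u
      ≡⟨ S.closedSum-+ adj (centered n ∘ p) (λ _ → + suc n) u ⟩
    closedSumℤ adj (centered n ∘ p) u ℤ.+ closedSumℤ adj (λ _ → + suc n) u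
      ≡⟨ cong (λ x → closedSumℤ adj (centered n ∘ p) u ℤ.+ x)
           (S.closedSum-const adj adjacent-regular (+ suc n) u) ⟩
    closedSumℤ adj (centered n ∘ p) u ℤ.+ (suc k S.· (+ suc n)) ∎
    where open ≡-Reasoning

  closedSum-centered≡0 : .{{_ : ℕ.NonZero n}} (π : Permutation′ n) (d : ℤ) →
    (∀ u → closedSumℤ adj (centered n ∘ (π ⟨$⟩ʳ_)) u ≡ d) → d ≡ 0ℤ
  closedSum-centered≡0 π d const with ℤ.i*j≡0⇒i≡0∨j≡0 (+ n) nd≡0
    where
    open ≡-Reasoning
    nd≡0 : + n ℤ.* d ≡ 0ℤ
    nd≡0 = begin
      + n ℤ.* d
        ≡⟨ ·-ℤ n d ⟨
      n S.· d
        ≡⟨ S.sum-replicate n ⟨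
      sumℤ {n} (λ _ → d)
        ≡⟨ S.sum-cong-≋ const ⟨
      sumℤ (closedSumℤ adj (centered n ∘ (π ⟨$⟩ʳ_)))
        ≡⟨ S.sum-closedSum adj adjacent-regular (adjacent-sym Γ) _ ⟩
      suc k S.· sumℤ (centered n ∘ (π ⟨$⟩ʳ_))
        ≡⟨ S.·-congʳ (suc k) (S.sum-permute (centered n) π) ⟨
      suc k S.· sumℤ (centered n)
        ≡⟨ S.·-congʳ (suc k) (sum-centered n) ⟩
      suc k S.· 0ℤ
        ≡⟨ ·-ℤ (suc k) 0ℤ ⟩
      + suc k ℤ.* 0ℤ
        ≡⟨ ℤ.*-zeroʳ (+ suc k) ⟩
      0ℤ ∎
  ... | inj₁ n≡0 = contradiction (ℤ.+-injective n≡0) (ℕ.≢-nonZero⁻¹ n)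
  ... | inj₂ d≡0 = d≡0

  magic⇒centered : .{{_ : ℕ.NonZero n}} (ℓ : Fin n ⤖ Fin n) →
    IsClosedDistanceMagicLabeling Γ ℓ →
    ∀ u → closedSumℤ adj (centered n ∘ Bijection.to ℓ) u ≡ 0ℤ
  magic⇒centered ℓ (r , _ , magic) u =
    trans (constant u) (closedSum-centered≡0 (⤖⇒↔ ℓ) _ constant)
    where
    c = suc k S.· (+ suc n)
    constant : ∀ u → closedSumℤ adj (centered n ∘ Bijection.to ℓ) u ≡ + (2 ℕ.* r) ℤ.- c
    constant u = begin
      s
        ≡⟨ cancel s c ⟩
      s ℤ.+ c ℤ.- c
        ≡⟨ cong (ℤ._- c) (double-closedSum (Bijection.to ℓ) u) ⟨
      + (2 ℕ.* closedSumℕ adj (label ℓ) u) ℤ.- c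
        ≡⟨ cong (λ m → + (2 ℕ.* m) ℤ.- c) (trans (sym (sum-N[] Γ (label ℓ) u)) (magic u)) ⟩
      + (2 ℕ.* r) ℤ.- c ∎
      where
      open ≡-Reasoning
      s = closedSumℤ adj (centered n ∘ Bijection.to ℓ) u
      cancel : ∀ x y → x ≡ x ℤ.+ y ℤ.- y
      cancel = ℤ-Tactic.solve-∀

  centered⇒magic : Fin n → (ℓ : Fin n ⤖ Fin n) →
    (∀ u → closedSumℤ adj (centered n ∘ Bijection.to ℓ) u ≡ 0ℤ) →
    IsClosedDistanceMagicLabeling Γ ℓ
  centered⇒magic u₀ ℓ balanced = closedSumℕ adj (label ℓ) u₀ , ℕ.z<s , λ u →
    trans (sum-N[] Γ (label ℓ) u)
      (ℕ.*-cancelˡ-≡ _ _ 2 (ℤ.+-injective (trans (constant u) (sym (constant u₀)))))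
    where
    c = suc k S.· (+ suc n)
    constant : ∀ u → + (2 ℕ.* closedSumℕ adj (label ℓ) u) ≡ 0ℤ ℤ.+ c
    constant u = trans (double-closedSum (Bijection.to ℓ) u) (cong (ℤ._+ c) (balanced u))

-- Taking the operations rather than a bundle as parameters, and a matrix M equal
-- to the indicator matrix rather than that matrix itself, makes the instance for ℂ
-- match the definitions of eigenvectors syntactically; otherwise the conversion
-- checker would compare proofs that sequences are Cauchy.
module _ {c ℓ} {Carrier : Set c} {_≈_ : Rel Carrier ℓ} {_+_ _*_ : Op₂ Carrier} { -_ : Op₁ Carrier}
  {0# 1# : Carrier} (isCommutativeRing : IsCommutativeRing _≈_ _+_ _*_ -_ 0# 1#) where

  private
    K : CommutativeRing c ℓ
    K = record { isCommutativeRing = isCommutativeRing }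

    ∑ : ∀ {n} → (Fin n → Carrier) → Carrier
    ∑ = RawMonoid.sum (record { _≈_ = _≈_ ; _∙_ = _+_ ; ε = 0# })

  open CommutativeRing K
    using (ring; setoid; +-rawMonoid; +-commutativeMonoid; +-abelianGroup;
      -‿inverseʳ; +-congˡ; *-congʳ; *-identityˡ; zeroˡ)
    renaming (sym to ≈-sym; trans to ≈-trans; reflexive to ≈-reflexive)
  open NeighborhoodSums +-commutativeMonoid using (closedSum; closedSum-cong; restrict; sum-cong-≋)
  open RingProperties ring using (-1*x≈-x)
  open AbelianGroupProperties +-abelianGroup using (inverseʳ-unique)
  open import Relation.Binary.Reasoning.Setoid setoid

  module _ {n} (adj : Fin n → Fin n → Bool) (M : Fin n → Fin n → Carrier)
    (M≡ : ∀ u w → M u w ≡ (if adj u w then 1# else 0#)) (v : Fin n → Carrier) (u : Fin n) where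

    Mv≈∑ : ∑ (λ w → M u w * v w) ≈ ∑ (restrict (adj u) v)
    Mv≈∑ = sum-cong-≋ λ w → ≈-trans (*-congʳ (≈-reflexive (M≡ u w))) (indicator* (adj u w) (v w))
      where
      indicator* : ∀ b x → ((if b then 1# else 0#) * x) ≈ (if b then x else 0#)
      indicator* true  x = *-identityˡ x
      indicator* false x = zeroˡ x

    eigen⇒closedSum≈0 : ∑ (λ w → M u w * v w) ≈ ((- 1#) * v u) → closedSum adj v u ≈ 0#
    eigen⇒closedSum≈0 eigen = begin
      v u + ∑ (restrict (adj u) v)    ≈⟨ +-congˡ Mv≈∑ ⟨
      v u + ∑ (λ w → M u w * v w)     ≈⟨ +-congˡ (≈-trans eigen (-1*x≈-x (v u))) ⟩
      v u + (- v u)                   ≈⟨ -‿inverseʳ (v u) ⟩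
      0#                              ∎

    closedSum≈0⇒eigen : closedSum adj v u ≈ 0# → ∑ (λ w → M u w * v w) ≈ ((- 1#) * v u)
    closedSum≈0⇒eigen balanced = begin
      ∑ (λ w → M u w * v w)   ≈⟨ Mv≈∑ ⟩
      ∑ (restrict (adj u) v)  ≈⟨ inverseʳ-unique (v u) _ balanced ⟩
      - v u                   ≈⟨ -1*x≈-x (v u) ⟨
      (- 1#) * v u            ∎

    module _ {φ : ℤ → Carrier} (φ-mono : IsMonoidMonomorphism ℤ.+-0-rawMonoid +-rawMonoid φ)
      (t : Fin n → ℤ) (v≈φt : ∀ x → v x ≈ φ (t x)) where

      open IsMonoidMonomorphism φ-mono

      closedSum≈φ : closedSum adj v u ≈ φ (closedSumℤ adj t u)
      closedSum≈φ = ≈-trans (closedSum-cong adj v≈φt u)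
        (≈-sym (closedSum-homo {M = ℤ.+-0-commutativeMonoid} {N = +-commutativeMonoid}
          isMonoidHomomorphism adj t u))

      eigen⇒closedSumℤ≡0 : ∑ (λ w → M u w * v w) ≈ ((- 1#) * v u) → closedSumℤ adj t u ≡ 0ℤ
      eigen⇒closedSumℤ≡0 eigen = injective (≈-trans (≈-sym closedSum≈φ)
        (≈-trans (eigen⇒closedSum≈0 eigen) (≈-sym ε-homo)))

      closedSumℤ≡0⇒eigen : closedSumℤ adj t u ≡ 0ℤ → ∑ (λ w → M u w * v w) ≈ ((- 1#) * v u)
      closedSumℤ≡0⇒eigen balanced = closedSum≈0⇒eigen
        (≈-trans closedSum≈φ (≈-trans (⟦⟧-cong balanced) ε-homo))

/2-homo-+ : ∀ i j → (i ℤ.+ j) ℚ./ 2 ≡ i ℚ./ 2 ℚ.+ j ℚ./ 2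
/2-homo-+ i j = ℚ.toℚᵘ-injective (begin-equality
  ℚ.toℚᵘ ((i ℤ.+ j) ℚ./ 2)
    ≃⟨ ℚ.toℚᵘ-fromℚᵘ (mkℚᵘ (i ℤ.+ j) 1) ⟩
  mkℚᵘ (i ℤ.+ j) 1
    ≃⟨ ℚᵘ.*≡* (ring i j) ⟩
  mkℚᵘ i 1 ℚᵘ.+ mkℚᵘ j 1
    ≃⟨ ℚᵘ.+-cong (ℚ.toℚᵘ-fromℚᵘ (mkℚᵘ i 1)) (ℚ.toℚᵘ-fromℚᵘ (mkℚᵘ j 1)) ⟨
  ℚ.toℚᵘ (i ℚ./ 2) ℚᵘ.+ ℚ.toℚᵘ (j ℚ./ 2)
    ≃⟨ ℚ.toℚᵘ-homo-+ (i ℚ./ 2) (j ℚ./ 2) ⟨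
  ℚ.toℚᵘ (i ℚ./ 2 ℚ.+ j ℚ./ 2) ∎)
  where
  open ℚᵘ.≤-Reasoning
  ring : ∀ i j → (i ℤ.+ j) ℤ.* + 4 ≡ (i ℤ.* + 2 ℤ.+ j ℤ.* + 2) ℤ.* + 2
  ring = ℤ-Tactic.solve-∀

/2-injective : ∀ {i j} → i ℚ./ 2 ≡ j ℚ./ 2 → i ≡ j
/2-injective {i} {j} eq
  with ℚᵘ.*≡* i*2≡j*2 ← ℚ.fromℚᵘ-injective {mkℚᵘ i 1} {mkℚᵘ j 1} eq
  = ℤ.*-cancelʳ-≡ i j (+ 2) i*2≡j*2

≈ℝ-pointwise : ∀ x y → (∀ n → seq x n ≡ seq y n) → x ≈ℝ y
≈ℝ-pointwise x y x≡y ε ε>0 = 0 , λ n _ →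
  subst (λ q → ℚ.∣ q ∣ ℚ.< ε) (sym (p≡q⇒p-q≡0 (x≡y n))) ε>0
  where
  p≡q⇒p-q≡0 : ∀ {p q} → p ≡ q → p ℚ.- q ≡ 0ℚ
  p≡q⇒p-q≡0 {p} refl = ℚ.+-inverseʳ p

fromℚ-injective : ∀ {p q} → fromℚ p ≈ℝ fromℚ q → p ≡ q
fromℚ-injective {p} {q} p≈q with p ℚ.≟ q
... | yes p≡q = p≡q
... | no p≢q = let N , close = p≈q ℚ.∣ p ℚ.- q ∣ ∣p-q∣>0 in
  contradiction (close N ℕ.≤-refl) (ℚ.<-irrefl refl)
  where
  open AbelianGroupProperties ℚ.+-0-abelianGroup using (x∙y⁻¹≈ε⇒x≈y)
  ∣p-q∣>0 : 0ℚ ℚ.< ℚ.∣ p ℚ.- q ∣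
  ∣p-q∣>0 = ℚ.≰⇒> λ ∣p-q∣≤0 → p≢q (x∙y⁻¹≈ε⇒x≈y p q
    (ℚ.∣p∣≡0⇒p≡0 (p ℚ.- q) (ℚ.≤-antisym ∣p-q∣≤0 (ℚ.0≤∣p∣ (p ℚ.- q)))))

halve : ℤ → ℂ
halve i = ℚ→ℂ (i ℚ./ 2)

halve-mono : IsMonoidMonomorphism ℤ.+-0-rawMonoid
  (CommutativeRing.+-rawMonoid ℂ-commutativeRing) halve
halve-mono = record
  { isMonoidHomomorphism = record
    { isMagmaHomomorphism = record
      { isRelHomomorphism = record { cong = λ {i} {j} i≡j →
            ≈ℝ-pointwise (re (halve i)) (re (halve j)) (λ _ → cong (ℚ._/ 2) i≡j)
          , ≈ℝ-pointwise (im (halve i)) (im (halve j)) (λ _ → refl) }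
      ; homo = λ i j →
            ≈ℝ-pointwise (re (halve (i ℤ.+ j))) (re (halve i +ℂ halve j)) (λ _ → /2-homo-+ i j)
          , ≈ℝ-pointwise (im (halve (i ℤ.+ j))) (im (halve i +ℂ halve j)) (λ _ → refl)
      }
    ; ε-homo = ≈ℝ-pointwise (re (halve 0ℤ)) (re 0ℂ) (λ _ → refl)
             , ≈ℝ-pointwise (im (halve 0ℤ)) (im 0ℂ) (λ _ → refl)
    }
  ; injective = λ {i} {j} (p , _) → /2-injective (fromℚ-injective p)
  }

private
  module ℂR = CommutativeRing ℂ-commutativeRing
  module Halve = IsMonoidMonomorphism halve-mono

reflexiveℂ : ∀ {z w} → z ≡ w → z ≈ℂ w
reflexiveℂ {z} refl = ℂR.refl {z}

module _ {n} {v : Vectorℂ n} (σ : Permutation′ n)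
  (vσ≈ : ∀ j → v (σ ⟨$⟩ʳ j) ≈ℂ ℚ→ℂ (arithmeticTerm n j)) where

  permutes⇒entry : ∀ x → v x ≈ℂ ℚ→ℂ (arithmeticTerm n (σ ⟨$⟩ˡ x))
  permutes⇒entry x = subst (λ y → v y ≈ℂ ℚ→ℂ (arithmeticTerm n (σ ⟨$⟩ˡ x)))
    (Perm.inverseʳ σ) (vσ≈ (σ ⟨$⟩ˡ x))

  permutes⇒distinct : PairwiseDistinct v
  permutes⇒distinct u w u≢w vu≈vw = u≢w (begin
    u                   ≡⟨ Perm.inverseʳ σ ⟨
    σ ⟨$⟩ʳ (σ ⟨$⟩ˡ u)   ≡⟨ cong (σ ⟨$⟩ʳ_) (centered-injective n
                             (Halve.injective
                               {centered n (σ ⟨$⟩ˡ u)} {centered n (σ ⟨$⟩ˡ w)} same)) ⟩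
    σ ⟨$⟩ʳ (σ ⟨$⟩ˡ w)   ≡⟨ Perm.inverseʳ σ ⟩
    w                   ∎)
    where
    open ≡-Reasoning
    h : Fin n → ℂ
    h x = ℚ→ℂ (arithmeticTerm n (σ ⟨$⟩ˡ x))
    same : h u ≈ℂ h w
    same = ℂR.trans {h u} {v u} {h w} (ℂR.sym {v u} {h u} (permutes⇒entry u))
      (ℂR.trans {v u} {v w} {h w} vu≈vw (permutes⇒entry w))

distinct⇒nonzero : ∀ {n} → 2 ≤ n → {v : Vectorℂ n} → PairwiseDistinct v →
  ¬ (∀ u → v u ≈ℂ 0ℂ)
distinct⇒nonzero (ℕ.s≤s (ℕ.s≤s _)) {v} distinct v≈0 = distinct zero (suc zero) (λ ())
  (ℂR.trans {v zero} {0ℂ} {v (suc zero)} (v≈0 zero)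
    (ℂR.sym {v (suc zero)} {0ℂ} (v≈0 (suc zero))))

ArithmeticEigenvector : ∀ {n} → Graph n → Set
ArithmeticEigenvector Γ =
  ∃[ v ] (IsEigenvector (adjacencyMatrix Γ) (-ℂ 1ℂ) v × PermutesToArithmetic v)

distinctEntries : ∀ {n} (Γ : Graph n) → ArithmeticEigenvector Γ →
  ∃[ v ] (IsEigenvector (adjacencyMatrix Γ) (-ℂ 1ℂ) v × PairwiseDistinct v)
distinctEntries Γ (v , eigen , σ , vσ≈) = v , eigen , permutes⇒distinct {v = v} σ vσ≈

module _ {n k} (2≤n : 2 ≤ n) (Γ : Graph n) (Γ-regular : Regular k Γ) where

  private
    instance
      n≢0 : ℕ.NonZero n
      n≢0 = ℕ.>-nonZero (ℕ.<⇒≤ 2≤n)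

    adj = adjacent Γ

    someVertex : Fin n
    someVertex = fromℕ< (ℕ.<⇒≤ 2≤n)

  closedSumℤ≡0⇒eigenvector : (t : Fin n → ℤ) {v : Vectorℂ n} → (∀ x → v x ≈ℂ halve (t x)) →
    ∀ u → closedSumℤ adj t u ≡ 0ℤ → (adjacencyMatrix Γ *ᵥ v) u ≈ℂ (-ℂ 1ℂ) *ℂ v u
  closedSumℤ≡0⇒eigenvector t {v} v≈ u balanced =
    closedSumℤ≡0⇒eigen {_≈_ = _≈ℂ_} {_+ℂ_} {_*ℂ_} { -ℂ_} {0ℂ} {1ℂ}
      (CommutativeRing.isCommutativeRing ℂ-commutativeRing)
      adj (adjacencyMatrix Γ) (λ _ _ → refl) v u halve-mono t v≈ balanced

  eigenvector⇒closedSumℤ≡0 : (t : Fin n → ℤ) {v : Vectorℂ n} → (∀ x → v x ≈ℂ halve (t x)) →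
    ∀ u → (adjacencyMatrix Γ *ᵥ v) u ≈ℂ (-ℂ 1ℂ) *ℂ v u → closedSumℤ adj t u ≡ 0ℤ
  eigenvector⇒closedSumℤ≡0 t {v} v≈ u eigen =
    eigen⇒closedSumℤ≡0 {_≈_ = _≈ℂ_} {_+ℂ_} {_*ℂ_} { -ℂ_} {0ℂ} {1ℂ}
      (CommutativeRing.isCommutativeRing ℂ-commutativeRing)
      adj (adjacencyMatrix Γ) (λ _ _ → refl) v u halve-mono t v≈ eigen

  magic⇒eigenvector : ClosedDistanceMagic Γ → ArithmeticEigenvector Γ
  magic⇒eigenvector (ℓ , magic) = v , (nonzero , eigen) , σ , vσ≈
    where
    σ : Permutation′ n
    σ = Perm.flip (⤖⇒↔ ℓ)
    v : Vectorℂ n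
    v x = ℚ→ℂ (arithmeticTerm n (Bijection.to ℓ x))
    vσ≡ : ∀ j → v (σ ⟨$⟩ʳ j) ≡ ℚ→ℂ (arithmeticTerm n j)
    vσ≡ j = cong (halve ∘ centered n) (Perm.inverseʳ (⤖⇒↔ ℓ))
    vσ≈ : ∀ j → v (σ ⟨$⟩ʳ j) ≈ℂ ℚ→ℂ (arithmeticTerm n j)
    vσ≈ j = reflexiveℂ {v (σ ⟨$⟩ʳ j)} {ℚ→ℂ (arithmeticTerm n j)} (vσ≡ j)
    nonzero : ¬ (∀ u → v u ≈ℂ 0ℂ)
    nonzero = distinct⇒nonzero 2≤n {v} (permutes⇒distinct {v = v} σ vσ≈)
    v≈ : ∀ x → v x ≈ℂ halve (centered n (Bijection.to ℓ x))
    v≈ x = reflexiveℂ {v x} {halve (centered n (Bijection.to ℓ x))} refl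
    eigen : ∀ u → (adjacencyMatrix Γ *ᵥ v) u ≈ℂ (-ℂ 1ℂ) *ℂ v u
    eigen u = closedSumℤ≡0⇒eigenvector (λ x → centered n (Bijection.to ℓ x)) {v} v≈ u
      (magic⇒centered Γ Γ-regular ℓ magic u)

  eigenvector⇒magic : ArithmeticEigenvector Γ → ClosedDistanceMagic Γ
  eigenvector⇒magic (v , (_ , eigen) , σ , vσ≈) = ℓ
    , centered⇒magic Γ Γ-regular someVertex ℓ λ u →
        eigenvector⇒closedSumℤ≡0 t {v} v≈ u (eigen u)
    where
    ℓ : Fin n ⤖ Fin n
    ℓ = ↔⇒⤖ (Perm.flip σ)
    t : Fin n → ℤ
    t x = centered n (σ ⟨$⟩ˡ x)
    v≈ : ∀ x → v x ≈ℂ halve (t x)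
    v≈ = permutes⇒entry {v = v} σ vσ≈

theorem2p2 : (n k : ℕ) → 2 ≤ n → (Γ : Graph n) → Regular k Γ →
    (ClosedDistanceMagic Γ ⇔
    (∃[ v ] (IsEigenvector (adjacencyMatrix Γ) (-ℂ 1ℂ) v × PermutesToArithmetic v)))
    × (ClosedDistanceMagic Γ →
    ∃[ v ] (IsEigenvector (adjacencyMatrix Γ) (-ℂ 1ℂ) v × PairwiseDistinct v))
theorem2p2 n k 2≤n Γ Γ-regular =
    mk⇔ {A = ClosedDistanceMagic Γ} {B = ArithmeticEigenvector Γ}
      (magic⇒eigenvector 2≤n Γ Γ-regular)
      (eigenvector⇒magic 2≤n Γ Γ-regular)
  , λ magic → distinctEntries Γ (magic⇒eigenvector 2≤n Γ Γ-regular magic)
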